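{- For any graph $G$ of order $n\ge 2$ with complement $\overline G$: (1) $\operatorname{th}_{\operatorname{Z}}(G)\cdot\operatorname{th}_{\operatorname{Z}}(\overline G)\le n^2$. (2) If each of $G$ and $\overline G$ has an edge, then $\operatorname{th}_{\operatorname{Z}}^{\ast}(G)+\operatorname{th}_{\operatorname{Z}}^{\ast}(\overline G)\le 2(n-1)$ and $\operatorname{th}_{\operatorname{Z}}^{\ast}(G)\cdot\operatorname{th}_{\operatorname{Z}}^{\ast}(\overline G)\le (n-1)^2$. All these bounds are sharp, i.e., each is attained by infinitely many graphs.
   Context: Graphs are finite, simple, undirected, with nonempty vertex set; the order of $G$ is $|V(G)|$; $\overline G$ is the complement of $G$. Standard zero forcing: each vertex is filled or unfilled. Color change rule: if $w$ is the unique unfilled neighbor of a filled vertex $v$, then fill $w$. For $B\subseteq V(G)$ put $B^{[0]}=B$, and let $B^{[i+1]}$ be $B^{[i]}$ together with all vertices that can be filled by one application of the rule when exactly the vertices of $B^{[i]}$ are filled. $\operatorname{pt}_{\operatorname{Z}}(G;B)$ is the least $t$ with $B^{[t]}=V(G)$ ($\infty$ if none exists), and $\operatorname{pt}_{\operatorname{Z}}(G,k)=\min_{|B|=k}\operatorname{pt}_{\operatorname{Z}}(G;B)$. For $G$ of order $n$: the sum throttling number is $\operatorname{th}_{\operatorname{Z}}(G)=\min_{1\le k\le n}(k+\operatorname{pt}_{\operatorname{Z}}(G,k))$, and, if $G$ has an edge, the no initial cost product throttling number is $\operatorname{th}_{\operatorname{Z}}^{\ast}(G)=\min_{1\le k\le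 n-1}k\cdot\operatorname{pt}_{\operatorname{Z}}(G,k)$. -}

module Defs where

open import Level using (0ℓ)
open import Data.Nat using (ℕ; zero; suc; _+_; _*_; _∸_; _≤_; _<_; s≤s; z≤n)
import Data.Nat as ℕ
import Data.Nat.Properties as ℕₚ
open import Data.Fin using (Fin)
import Data.Fin.Properties as Fin
open import Data.Fin.Subset
  using (Subset; inside; outside; _∈_; _∉_; ⊤; _∪_; ∣_∣)
open import Data.Fin.Subset.Properties
  using (_∈?_; p⊆p∪q; ⊆-antisym; p⊂q⇒∣p∣<∣q∣; ∣p∣≤n; ∣p∣≡n⇒p≡⊤)
open import Data.Bool.Properties using () renaming (_≟_ to _≟ᵇ_)
open import Data.Vec using ([]; _∷_; tabulate)
open import Data.Vec.Properties using (≡-dec)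
open import Data.List using (List; []; _∷_; _++_; map; filter; upTo)
open import Data.List.Membership.Propositional using (lose) renaming (_∈_ to _∈ᴸ_)
open import Data.List.Membership.Propositional.Properties
  using (∈-map⁺; ∈-map⁻; ∈-++⁺ˡ; ∈-++⁺ʳ; ∈-filter⁺; ∈-filter⁻; ∈-upTo⁺)
open import Data.List.Relation.Unary.Any using (here)
import Data.List.Extrema as Extrema
open import Data.Product using (∃; ∃-syntax; _×_; _,_; proj₁; proj₂)
open import Data.Sum using (_⊎_; inj₁; inj₂)
open import Function using (_∘_)
open import Relation.Nullary using (¬_; Dec; yes; no; does; contradiction)
open import Relation.Nullary.Decidable using (_×-dec_; _→-dec_; ¬?; decidable-stable)
open import Relation.Nullary.Construct.Add.Supremum public using (_⁺; [_]; ⊤⁺)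
import Relation.Binary.Construct.Add.Supremum.NonStrict as AddSup
open import Relation.Binary.Core using (Rel)
open import Relation.Binary.Bundles using (TotalOrder)
open import Relation.Binary.Definitions using (Decidable; Symmetric)
open import Relation.Binary.PropositionalEquality
  using (_≡_; _≢_; refl; sym; trans; cong; subst)

private
  variable
    n : ℕ

------------------------------------------------------------------------
-- ℕ ∪ {∞}, where ⊤⁺ is ∞

ℕ∞ : Set
ℕ∞ = ℕ ⁺

open AddSup _≤_ public using (_≤⁺_; _≤⊤⁺; [_])

≤⁺-totalOrder : TotalOrder 0ℓ 0ℓ 0ℓ
≤⁺-totalOrder = record
  { isTotalOrder = AddSup.≤⁺-isTotalOrder-≡ _≤_ ℕₚ.≤-isTotalOrder }

infixl 6 _+⁺_
infixl 7 _*⁺_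

_+⁺_ : ℕ∞ → ℕ∞ → ℕ∞
[ a ] +⁺ [ b ] = [ a + b ]
[ _ ] +⁺ ⊤⁺    = ⊤⁺
⊤⁺    +⁺ _     = ⊤⁺

-- 0 · ∞ = ∞ by convention; in k · pt(G,k) the factor k is always positive.
_*⁺_ : ℕ∞ → ℕ∞ → ℕ∞
[ a ] *⁺ [ b ] = [ a * b ]
[ _ ] *⁺ ⊤⁺    = ⊤⁺
⊤⁺    *⁺ _     = ⊤⁺

-- The minimum of the empty list is ∞.
minimum : List ℕ∞ → ℕ∞
minimum = Extrema.min ≤⁺-totalOrder ⊤⁺

------------------------------------------------------------------------
-- Graphs

-- Decidability of adjacency is the constructive content of "finite graph".
record Graph (n : ℕ) : Set₁ where
  field
    Adj    : Rel (Fin n) 0ℓ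
    adj?   : Decidable Adj
    symm   : Symmetric Adj
    irrefl : ∀ v → ¬ Adj v v

complement : Graph n → Graph n
complement G = record
  { Adj    = λ u v → u ≢ v × ¬ Adj u v
  ; adj?   = λ u v → ¬? (u Fin.≟ v) ×-dec ¬? (adj? u v)
  ; symm   = λ (u≢v , ¬uv) → u≢v ∘ sym , ¬uv ∘ symm
  ; irrefl = λ v (v≢v , _) → v≢v refl
  }
  where open Graph G

HasEdge : Graph n → Set
HasEdge G = ∃[ u ] ∃[ v ] Graph.Adj G u v

-- Up to isomorphism there are only finitely many graphs of each order, so a
-- family of graphs is infinite exactly when it contains graphs of
-- arbitrarily large order.
InfinitelyManyGraphs : (∀ {n} → Graph n → Set) → Set₁
InfinitelyManyGraphs P = ∀ N → ∃[ n ] N ≤ n × (∃ λ (G : Graph n) → P G)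

------------------------------------------------------------------------
-- Zero forcing

module _ (G : Graph n) where
  open Graph G

  -- v forces w when exactly the vertices of B are filled.
  Forces : Subset n → Fin n → Fin n → Set
  Forces B v w =
    v ∈ B × Adj v w × w ∉ B × (∀ u → Adj v u → u ∉ B → u ≡ w)

  forces? : ∀ B → Decidable (Forces B)
  forces? B v w =
    (v ∈? B) ×-dec adj? v w ×-dec ¬? (w ∈? B) ×-dec
    Fin.all? (λ u → adj? v u →-dec (¬? (u ∈? B) →-dec (u Fin.≟ w)))

  step : Subset n → Subset n
  step B = B ∪ tabulate (λ w → does (Fin.any? (λ v → forces? B v w)))

  -- filled B i is B^[i].
  filled : Subset n → ℕ → Subset n
  filled B zero    = B
  filled B (suc i) = step (filled B i)

  allFilled? : ∀ B t → Dec (filled B t ≡ ⊤)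
  allFilled? B t = ≡-dec _≟ᵇ_ (filled B t) ⊤

  -- The search is cut off at t = n; pt-least and pt-attained below show that
  -- pt B is nevertheless the least of all t with B^[t] = V(G), and ∞ if there
  -- is no such t.
  pt : Subset n → ℕ∞
  pt B = minimum (map [_] (filter (allFilled? B) (upTo (suc n))))

subsets : ∀ n → List (Subset n)
subsets zero    = [] ∷ []
subsets (suc n) = map (inside ∷_) (subsets n) ++ map (outside ∷_) (subsets n)

subsetsOfSize : ∀ n → ℕ → List (Subset n)
subsetsOfSize n k = filter (λ B → ∣ B ∣ ℕ.≟ k) (subsets n)

ptₖ : Graph n → ℕ → ℕ∞
ptₖ {n} G k = minimum (map (pt G) (subsetsOfSize n k))

-- 1 , 2 , … , m
range : ℕ → List ℕ
range m = map suc (upTo m)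

th : Graph n → ℕ∞
th {n} G = minimum (map (λ k → [ k ] +⁺ ptₖ G k) (range n))

-- Takes the value ∞ when G has no edge.
th* : Graph n → ℕ∞
th* {n} G = minimum (map (λ k → [ k ] *⁺ ptₖ G k) (range (n ∸ 1)))

------------------------------------------------------------------------
-- Adequacy of subsets and pt

∈-subsets : (B : Subset n) → B ∈ᴸ subsets n
∈-subsets []            = here refl
∈-subsets (inside  ∷ B) = ∈-++⁺ˡ (∈-map⁺ (inside ∷_) (∈-subsets B))
∈-subsets (outside ∷ B) =
  ∈-++⁺ʳ (map (inside ∷_) (subsets _)) (∈-map⁺ (outside ∷_) (∈-subsets B))

minimum-≤ : ∀ {x xs} → x ∈ᴸ xs → minimum xs ≤⁺ x
minimum-≤ {x} {xs} x∈xs =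
  Extrema.min≤v⁺ ≤⁺-totalOrder ⊤⁺ xs
    (inj₂ (lose x∈xs (TotalOrder.refl ≤⁺-totalOrder)))

minimum-attained : ∀ xs {m} → minimum xs ≡ [ m ] → [ m ] ∈ᴸ xs
minimum-attained xs eq with Extrema.argmin-sel ≤⁺-totalOrder (λ x → x) ⊤⁺ xs
... | inj₁ eq′  = contradiction (trans (sym eq) eq′) (λ ())
... | inj₂ x∈xs = subst (_∈ᴸ xs) eq x∈xs

module _ (G : Graph n) (B : Subset n) where

  private
    f : ℕ → Subset n
    f = filled G B

    step-grows : ∀ C → step G C ≡ C ⊎ ∣ C ∣ < ∣ step G C ∣
    step-grows C with Fin.any? (λ x → (x ∈? step G C) ×-dec ¬? (x ∈? C))
    ... | yes new = inj₂ (p⊂q⇒∣p∣<∣q∣ (p⊆p∪q _ , new))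
    ... | no ¬new = inj₁ (⊆-antisym
      (λ {x} x∈ → decidable-stable (x ∈? C) (λ x∉ → ¬new (x , x∈ , x∉)))
      (p⊆p∪q _))

    grows : ∀ i → i ≤ ∣ f i ∣ ⊎ (∃[ j ] j < i × f (suc j) ≡ f j)
    grows zero = inj₁ z≤n
    grows (suc i) with grows i
    ... | inj₂ (j , j<i , eq) = inj₂ (j , ℕₚ.m<n⇒m<1+n j<i , eq)
    ... | inj₁ i≤ with step-grows (f i)
    ...   | inj₁ eq = inj₂ (i , ℕₚ.≤-refl , eq)
    ...   | inj₂ lt = inj₁ (ℕₚ.≤-<-trans i≤ lt)

    stationary : ∀ {j} → f (suc j) ≡ f j → ∀ d → f (d + j) ≡ f j
    stationary eq zero    = refl
    stationary eq (suc d) = trans (cong (step G) (stationary eq d)) eq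

    early : ∀ t → f t ≡ ⊤ → ∃[ s ] s ≤ n × s ≤ t × f s ≡ ⊤
    early t ft with ℕₚ.≤-total t n
    ... | inj₁ t≤n = t , t≤n , ℕₚ.≤-refl , ft
    ... | inj₂ n≤t with grows n
    ...   | inj₁ n≤ =
      n , ℕₚ.≤-refl , n≤t , ∣p∣≡n⇒p≡⊤ (ℕₚ.≤-antisym (∣p∣≤n (f n)) n≤)
    ...   | inj₂ (j , j<n , eq) =
      j , ℕₚ.<⇒≤ j<n , j≤t ,
      trans (sym (stationary eq (t ∸ j)))
            (trans (cong f (ℕₚ.m∸n+n≡m j≤t)) ft)
      where j≤t = ℕₚ.≤-trans (ℕₚ.<⇒≤ j<n) n≤t

  pt-least : ∀ t → filled G B t ≡ ⊤ → pt G B ≤⁺ [ t ]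
  pt-least t ft with early t ft
  ... | s , s≤n , s≤t , fs = TotalOrder.trans ≤⁺-totalOrder
    (minimum-≤ (∈-map⁺ [_] (∈-filter⁺ (allFilled? G B) (∈-upTo⁺ (s≤s s≤n)) fs)))
    [ s≤t ]

  pt-attained : ∀ {t} → pt G B ≡ [ t ] → filled G B t ≡ ⊤
  pt-attained eq
    with ∈-map⁻ [_] (minimum-attained
           (map [_] (filter (allFilled? G B) (upTo (suc n)))) eq)
  ... | _ , t∈ , refl = proj₂ (∈-filter⁻ (allFilled? G B) {xs = upTo (suc n)} t∈)

{-# OPTIONS --safe #-}

-- The upper bounds come from filling all vertices, resp. all but one
-- non-isolated vertex, at the start.
--
-- Every bound is attained by the stars K_{1,n-1}.  The leaves of
-- a star are pairwise twins, both in the star and in its complement, and of two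
-- unfilled twins neither is ever filled.  Hence a forcing set B omits at most
-- one leaf; if it omits the center as well, these two vertices cannot both be
-- filled in the first step.  So |B| + t ≥ n whenever B^[t] = V(G), which gives
-- th = n, and then th* ≥ n - 1 because (k - 1)(t - 1) ≥ 0.
module Submission where

open import Defs
open import Data.Nat using (ℕ; zero; suc; _+_; _*_; _∸_; _^_; _≤_; _<_; z≤n; s≤s)
import Data.Nat.Properties as ℕₚ
open import Data.Fin using (Fin; zero; suc)
import Data.Fin.Properties as Fin
open import Data.Fin.Subset
  using (Subset; inside; outside; _∈_; _∉_; ⊤; ∁; ⁅_⁆; ∣_∣)
open import Data.Fin.Subset.Properties
open import Data.Bool using (true)
open import Data.Vec using ([]; _∷_)
open import Data.Vec.Properties using (lookup∘tabulate; lookup⇒[]=; []=⇒lookup)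
open import Data.List using (map)
open import Data.List.Membership.Propositional.Properties
  using (∈-map⁺; ∈-map⁻; ∈-filter⁺; ∈-filter⁻; ∈-upTo⁺)
import Data.List.Relation.Unary.All.Properties as All
import Data.List.Extrema as Extrema
open import Data.Product using (∃-syntax; _×_; _,_; proj₁; proj₂)
open import Data.Sum using (_⊎_; inj₁; inj₂; swap)
open import Function using (_∘_)
open import Relation.Nullary using (¬_; Dec; yes; no; does; contradiction)
open import Relation.Nullary.Decidable
  using (dec-true; decidable-stable; ¬?; _×-dec_; _⊎-dec_)
open import Relation.Binary.Bundles using (TotalOrder)
open import Relation.Binary.PropositionalEquality
  using (_≡_; _≢_; refl; sym; trans; cong; cong₂; subst)

open TotalOrder ≤⁺-totalOrder using () renaming (trans to ≤⁺-trans; antisym to ≤⁺-antisym)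

private
  variable
    n m k t : ℕ

-- Preliminaries on minima and cardinalities.

does⇒ : ∀ {A : Set} (a? : Dec A) → does a? ≡ true → A
does⇒ (yes a) _ = a

+⁺-mono : ∀ {a b c d} → a ≤⁺ [ c ] → b ≤⁺ [ d ] → a +⁺ b ≤⁺ [ c + d ]
+⁺-mono [ p ] [ q ] = [ ℕₚ.+-mono-≤ p q ]

*⁺-mono : ∀ {a b c d} → a ≤⁺ [ c ] → b ≤⁺ [ d ] → a *⁺ b ≤⁺ [ c * d ]
*⁺-mono [ p ] [ q ] = [ ℕₚ.*-mono-≤ p q ]

minimum-range-≤ : ∀ (f : ℕ → ℕ∞) m → minimum (map f (range (suc m))) ≤⁺ f (suc m)
minimum-range-≤ f m = minimum-≤ (∈-map⁺ f (∈-map⁺ suc (∈-upTo⁺ ℕₚ.≤-refl)))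

minimum-range-≥ : ∀ {v} (f : ℕ → ℕ∞) m → (∀ j → j < m → v ≤⁺ f (suc j)) →
                  v ≤⁺ minimum (map f (range m))
minimum-range-≥ {v} f m v≤ =
  Extrema.v≤min⁺ ≤⁺-totalOrder (v ≤⊤⁺)
    (All.map⁺ (All.map⁺ (All.applyUpTo⁺₁ _ m (v≤ _))))

n*n≡n^2 : ∀ n → n * n ≡ n ^ 2
n*n≡n^2 n = cong (n *_) (sym (ℕₚ.*-identityʳ n))

n+n≡2*n : ∀ n → n + n ≡ 2 * n
n+n≡2*n n = cong (n +_) (sym (ℕₚ.+-identityʳ n))

n≤∣B∣ : (B : Subset n) → (∀ x → x ∈ B) → n ≤ ∣ B ∣
n≤∣B∣ {n} B all = subst (_≤ ∣ B ∣) (∣⊤∣≡n n) (p⊆q⇒∣p∣≤∣q∣ {p = ⊤} (λ {x} _ → all x))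

-- At the first `outside` entry uniqueness puts every later index into the set, so `n≤∣B∣` counts
-- the tail exactly.
n≤1+∣B∣ : (B : Subset n) → (∀ {x y} → x ∉ B → y ∉ B → x ≡ y) → n ≤ suc ∣ B ∣
n≤1+∣B∣ []            _      = z≤n
n≤1+∣B∣ (inside ∷ B)  unique =
  s≤s (n≤1+∣B∣ B λ x∉ y∉ → Fin.suc-injective
    (unique (x∉ ∘ drop-there) (y∉ ∘ drop-there)))
n≤1+∣B∣ (outside ∷ B) unique =
  s≤s (n≤∣B∣ B λ x → decidable-stable (x ∈? B) λ x∉ →
    Fin.0≢1+n (unique (λ ()) (x∉ ∘ drop-there)))

-- Forcing steps and the upper bounds.

module _ (G : Graph n) where
  open Graph G

  ∈-step⁻ : ∀ {B w} → w ∈ step G B → w ∈ B ⊎ ∃[ v ] Forces G B v w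
  ∈-step⁻ {B} {w} w∈ with x∈p∪q⁻ B _ w∈
  ... | inj₁ w∈B = inj₁ w∈B
  ... | inj₂ w∈T = inj₂ (does⇒ (Fin.any? (λ v → forces? G B v w))
    (trans (sym (lookup∘tabulate _ w)) ([]=⇒lookup w∈T)))

  ∈-step⁺ : ∀ {B v w} → Forces G B v w → w ∈ step G B
  ∈-step⁺ {B} {v} {w} f = x∈p∪q⁺ {p = B} (inj₂ (lookup⇒[]= w _
    (trans (lookup∘tabulate _ w)
      (dec-true (Fin.any? (λ v → forces? G B v w)) (v , f)))))

  ptₖ-least : ∀ B t → filled G B t ≡ ⊤ → ptₖ G ∣ B ∣ ≤⁺ [ t ]
  ptₖ-least B t eq = ≤⁺-trans
    (minimum-≤ (∈-map⁺ (pt G) (∈-filter⁺ _ (∈-subsets B) refl)))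
    (pt-least G B t eq)

  ptₖ-attained : ptₖ G k ≡ [ t ] → ∃[ B ] ∣ B ∣ ≡ k × filled G B t ≡ ⊤
  ptₖ-attained {k} eq
    with ∈-map⁻ (pt G) (minimum-attained (map (pt G) (subsetsOfSize n k)) eq)
  ... | B , B∈ , eq′ =
    B , proj₂ (∈-filter⁻ _ {xs = subsets n} B∈) , pt-attained G B (sym eq′)

  th≤n : 1 ≤ n → th G ≤⁺ [ n ]
  th≤n (s≤s {n = m} _) = ≤⁺-trans
    (minimum-range-≤ (λ k → [ k ] +⁺ ptₖ G k) m)
    (subst (λ s → [ n ] +⁺ ptₖ G n ≤⁺ [ s ]) (ℕₚ.+-identityʳ n)
      (+⁺-mono [ ℕₚ.≤-refl {n} ]
        (subst (λ k → ptₖ G k ≤⁺ [ 0 ]) (∣⊤∣≡n n) (ptₖ-least ⊤ 0 refl))))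

  -- By irreflexivity `v` is not `w`, hence filled, and `w` is the only unfilled vertex of the
  -- graph, so `v` forces it at once.
  filled-∁⁅w⁆ : ∀ {v w} → Adj v w → filled G (∁ ⁅ w ⁆) 1 ≡ ⊤
  filled-∁⁅w⁆ {v} {w} vw = ⊆-antisym ⊆⊤ λ {x} _ → x∈ x
    where
    unfilled≡w : ∀ {u} → u ∉ ∁ ⁅ w ⁆ → u ≡ w
    unfilled≡w = x∈⁅y⁆⇒x≡y w ∘ x∉∁p⇒x∈p

    ≢w⇒∈ : ∀ {u} → u ≢ w → u ∈ ∁ ⁅ w ⁆
    ≢w⇒∈ = x∉p⇒x∈∁p ∘ x≢y⇒x∉⁅y⁆

    x∈ : ∀ x → x ∈ step G (∁ ⁅ w ⁆)
    x∈ x with x Fin.≟ w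
    ... | no x≢w   = x∈p∪q⁺ (inj₁ (≢w⇒∈ x≢w))
    ... | yes refl = ∈-step⁺
      ( ≢w⇒∈ (λ { refl → irrefl v vw }) , vw
      , x∈p⇒x∉∁p (x∈⁅x⁆ w) , λ _ _ → unfilled≡w )

  th*≤n-1 : 2 ≤ n → HasEdge G → th* G ≤⁺ [ n ∸ 1 ]
  th*≤n-1 (s≤s (s≤s {n = m} _)) (v , w , vw) = ≤⁺-trans
    -- The last entry of the range, k = n - 1, is the size of `∁ ⁅ w ⁆`.
    (minimum-range-≤ (λ k → [ k ] *⁺ ptₖ G k) m)
    (subst (λ s → [ suc m ] *⁺ ptₖ G (suc m) ≤⁺ [ s ]) (ℕₚ.*-identityʳ (suc m))
      (*⁺-mono [ ℕₚ.≤-refl {suc m} ]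
        (subst (λ k → ptₖ G k ≤⁺ [ 1 ])
          (trans (∣∁p∣≡n∸∣p∣ ⁅ w ⁆) (cong (n ∸_) (∣⁅x⁆∣≡1 w)))
          (ptₖ-least (∁ ⁅ w ⁆) 1 (filled-∁⁅w⁆ vw)))))

  -- Reduction of both lower bounds to |B| + t ≥ n.

  module _ (bound : ∀ B t → filled G B t ≡ ⊤ → n ≤ ∣ B ∣ + t) where

    ptₖ-bound : ptₖ G k ≡ [ t ] → n ≤ k + t
    ptₖ-bound eq with ptₖ-attained eq
    ... | B , refl , ft = bound B _ ft

    n≤th : [ n ] ≤⁺ th G
    n≤th = minimum-range-≥ _ n at
      where
      at : ∀ j → j < n → [ n ] ≤⁺ [ suc j ] +⁺ ptₖ G (suc j)
      at j _ with ptₖ G (suc j) in eq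
      ... | [ t ] = [ ptₖ-bound eq ]
      ... | ⊤⁺    = _ ≤⊤⁺

    n-1≤th* : [ n ∸ 1 ] ≤⁺ th* G
    n-1≤th* = minimum-range-≥ _ (n ∸ 1) at
      where
      product : ∀ {n} j t → j < n ∸ 1 → n ≤ suc j + t → n ∸ 1 ≤ suc j * t
      -- A zero propagation time would make the product 0, but then k ≥ n, and the range of `th*`
      -- stops at n - 1.
      product {suc n} j zero j<n (s≤s n≤) =
        contradiction (ℕₚ.<-≤-trans j<n n≤) (ℕₚ.<-irrefl (sym (ℕₚ.+-identityʳ j)))
      product {suc n} j (suc i) _ (s≤s n≤) = begin
        n                   ≤⟨ n≤ ⟩
        j + suc i           ≡⟨ ℕₚ.+-comm j (suc i) ⟩
        -- With k = j + 1 and t = i + 1, the inequality j ≤ j (i + 1) is (k - 1)(t - 1) ≥ 0.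
        suc i + j           ≤⟨ ℕₚ.+-monoʳ-≤ (suc i) (ℕₚ.m≤m*n j (suc i)) ⟩
        suc i + j * suc i   ∎
        where open ℕₚ.≤-Reasoning

      at : ∀ j → j < n ∸ 1 → [ n ∸ 1 ] ≤⁺ [ suc j ] *⁺ ptₖ G (suc j)
      at j j< with ptₖ G (suc j) in eq
      ... | [ t ] = [ product j t j< (ptₖ-bound eq) ]
      ... | ⊤⁺    = _ ≤⊤⁺

-- Twin vertices and the lower bound for twin leaves.

-- One inclusion of neighborhoods, with `x` and `y` themselves left out: twins may be adjacent or
-- not, as leaves are in the complement of a star and in the star.
Twins : Graph n → Fin n → Fin n → Set
Twins G x y = ∀ {v} → v ≢ x → v ≢ y → Graph.Adj G v x → Graph.Adj G v y

module _ (G : Graph n) {x y : Fin n} (x≢y : x ≢ y)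
         (xy : Twins G x y) (yx : Twins G y x) where

  private
    -- A filled `v` differs from both unfilled twins, so if it is adjacent to `x` it has `y` as a
    -- second unfilled neighbor.
    not-forced : ∀ {x y B v} → Twins G x y → x ≢ y → x ∉ B → y ∉ B → ¬ Forces G B v x
    not-forced xy x≢y x∉ y∉ (v∈ , vx , _ , only) =
      x≢y (sym (only _ (xy (λ { refl → x∉ v∈ }) (λ { refl → y∉ v∈ }) vx) y∉))

  twins-unfilled : ∀ {B} → x ∉ B → y ∉ B → ∀ t → x ∉ filled G B t × y ∉ filled G B t
  twins-unfilled x∉ y∉ zero = x∉ , y∉
  twins-unfilled x∉ y∉ (suc t) with twins-unfilled x∉ y∉ t
  ... | x∉ₜ , y∉ₜ = stays x∉ₜ (not-forced xy x≢y x∉ₜ y∉ₜ)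
                  , stays y∉ₜ (not-forced yx (x≢y ∘ sym) y∉ₜ x∉ₜ)
    where
    stays : ∀ {w C} → w ∉ C → (∀ {v} → ¬ Forces G C v w) → w ∉ step G C
    stays w∉ ¬f w∈ with ∈-step⁻ G w∈
    ... | inj₁ w∈C     = w∉ w∈C
    ... | inj₂ (_ , f) = ¬f f

-- Vertex `zero` is the center. Only the twin relation is recorded, so that one argument serves the
-- star and its complement.
TwinLeaves : Graph (suc m) → Set
TwinLeaves G = ∀ x y → Twins G (suc x) (suc y)

-- Non-adjacency passes from `x` to `y` by the contrapositive of the twin inclusion from `y` to `x`.
twinLeaves-complement : (G : Graph (suc m)) → TwinLeaves G → TwinLeaves (complement G)
twinLeaves-complement G tw x y v≢x v≢y (_ , ¬vx) = v≢y , ¬vx ∘ tw y x v≢y v≢x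

module _ (G : Graph (suc m)) (tw : TwinLeaves G) where
  open Graph G

  leaves-unique : ∀ {B} t → filled G B t ≡ ⊤ → ∀ {x y} → suc x ∉ B → suc y ∉ B → x ≡ y
  leaves-unique t ft {x} {y} x∉ y∉ = decidable-stable (x Fin.≟ y) λ x≢y →
    proj₁ (twins-unfilled G (x≢y ∘ Fin.suc-injective) (tw x y) (tw y x) x∉ y∉ t)
      (subst (suc x ∈_) (sym ft) ∈⊤)

  -- If u forces the center and v forces the leaf x, then v is adjacent to the
  -- center too, as its twin u is.
  center-filled : ∀ {B x} → filled G B 1 ≡ ⊤ → zero ∉ B → suc x ∉ B → zero ∈ B
  center-filled {B} {x} f1 0∉ x∉
    with ∈-step⁻ G (subst (zero ∈_) (sym f1) ∈⊤)
       | ∈-step⁻ G (subst (suc x ∈_) (sym f1) ∈⊤)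
  ... | inj₁ 0∈ | _       = 0∈
  ... | inj₂ _  | inj₁ x∈ = contradiction x∈ x∉
  ... | inj₂ (zero , 0∈ , _) | inj₂ _ = 0∈
  ... | inj₂ (suc u , _) | inj₂ (zero , 0∈ , _) = 0∈
  ... | inj₂ (suc u , _ , u0 , _) | inj₂ (suc v , _ , _ , _ , only) =
    contradiction (only zero (symm (tw u v (λ ()) (λ ()) (symm u0))) 0∉) λ ()

  step-unique : ∀ {B} → filled G B 1 ≡ ⊤ → ∀ {x y} → x ∉ B → y ∉ B → x ≡ y
  step-unique f1 {zero}  {zero}  _  _  = refl
  step-unique f1 {zero}  {suc y} 0∉ y∉ = contradiction (center-filled f1 0∉ y∉) 0∉
  step-unique f1 {suc x} {zero}  x∉ 0∉ = contradiction (center-filled f1 0∉ x∉) 0∉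
  step-unique f1 {suc x} {suc y} x∉ y∉ = cong suc (leaves-unique 1 f1 x∉ y∉)

  -- The number of vertices missing from `B` is 0 for t = 0, at most 1 for t = 1, and never more
  -- than 2: the center and one leaf.
  n≤∣B∣+t : ∀ B t → filled G B t ≡ ⊤ → suc m ≤ ∣ B ∣ + t
  n≤∣B∣+t B 0 refl = ℕₚ.≤-trans (n≤∣B∣ B (λ _ → ∈⊤)) (ℕₚ.m≤m+n _ _)
  n≤∣B∣+t B 1 f1   = subst (suc m ≤_) (ℕₚ.+-comm 1 ∣ B ∣) (n≤1+∣B∣ B (step-unique f1))
  -- Here `b` stands for the center and `B` for the leaves alone. The center is counted as missing
  -- whatever `b` is, since t ≥ 2 pays for it and one leaf.
  n≤∣B∣+t (b ∷ B) t@(suc (suc s)) ft = begin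
    suc m               ≤⟨ s≤s (n≤1+∣B∣ B λ x∉ y∉ → leaves-unique t ft
                             (x∉ ∘ drop-there) (y∉ ∘ drop-there)) ⟩
    2 + ∣ B ∣           ≤⟨ ℕₚ.+-mono-≤ (ℕₚ.m≤m+n 2 s) (∣p∣≤∣x∷p∣ b B) ⟩
    t + ∣ b ∷ B ∣       ≡⟨ ℕₚ.+-comm t ∣ b ∷ B ∣ ⟩
    ∣ b ∷ B ∣ + t       ∎
    where open ℕₚ.≤-Reasoning

  th≡n : th G ≡ [ suc m ]
  th≡n = ≤⁺-antisym (th≤n G (s≤s z≤n)) (n≤th G n≤∣B∣+t)

  th*≡n-1 : 2 ≤ suc m → HasEdge G → th* G ≡ [ m ]
  th*≡n-1 2≤n e = ≤⁺-antisym (th*≤n-1 G 2≤n e) (n-1≤th* G n≤∣B∣+t)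

-- Stars and the sharpness of the bounds.

star : ∀ m → Graph (suc m)
star m = record
  { Adj    = λ u v → u ≢ v × (u ≡ zero ⊎ v ≡ zero)
  ; adj?   = λ u v → ¬? (u Fin.≟ v) ×-dec (u Fin.≟ zero ⊎-dec v Fin.≟ zero)
  ; symm   = λ (u≢v , c) → u≢v ∘ sym , swap c
  ; irrefl = λ _ (v≢v , _) → v≢v refl
  }

-- The only neighbor of a leaf is the center, which is adjacent to every leaf.
star-twinLeaves : TwinLeaves (star m)
star-twinLeaves _ _ _ v≢y (_ , inj₁ v≡0) = v≢y , inj₁ v≡0

proposition2p3 : (∀ n → 2 ≤ n → (G : Graph n) →
    (th G *⁺ th (complement G) ≤⁺ [ n ^ 2 ])
    × (HasEdge G → HasEdge (complement G) →
    (th* G +⁺ th* (complement G) ≤⁺ [ 2 * (n ∸ 1) ])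
    × (th* G *⁺ th* (complement G) ≤⁺ [ (n ∸ 1) ^ 2 ])))
    × InfinitelyManyGraphs (λ {n} G →
    2 ≤ n × th G *⁺ th (complement G) ≡ [ n ^ 2 ])
    × InfinitelyManyGraphs (λ {n} G →
    2 ≤ n × HasEdge G × HasEdge (complement G)
    × th* G +⁺ th* (complement G) ≡ [ 2 * (n ∸ 1) ])
    × InfinitelyManyGraphs (λ {n} G →
    2 ≤ n × HasEdge G × HasEdge (complement G)
    × th* G *⁺ th* (complement G) ≡ [ (n ∸ 1) ^ 2 ])
proposition2p3 =
    (λ n 2≤n G → let 1≤n = ℕₚ.<⇒≤ 2≤n ; Ḡ = complement G in
      subst (λ s → th G *⁺ th Ḡ ≤⁺ [ s ]) (n*n≡n^2 n)
        (*⁺-mono (th≤n G 1≤n) (th≤n Ḡ 1≤n))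
      , λ e ē →
          subst (λ s → th* G +⁺ th* Ḡ ≤⁺ [ s ]) (n+n≡2*n (n ∸ 1))
            (+⁺-mono (th*≤n-1 G 2≤n e) (th*≤n-1 Ḡ 2≤n ē))
        , subst (λ s → th* G *⁺ th* Ḡ ≤⁺ [ s ]) (n*n≡n^2 (n ∸ 1))
            (*⁺-mono (th*≤n-1 G 2≤n e) (th*≤n-1 Ḡ 2≤n ē)))
  , (λ N → 3 + N , N≤3+N N , S N , 2≤ ,
      trans (cong₂ _*⁺_ (th≡n (S N) tw) (th≡n (S̄ N) t̄w))
            (cong [_] (n*n≡n^2 (3 + N))))
  , (λ N → 3 + N , N≤3+N N , S N , 2≤ , edge , ēdge ,
      trans (cong₂ _+⁺_ (th*≡n-1 (S N) tw 2≤ edge) (th*≡n-1 (S̄ N) t̄w 2≤ ēdge))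
            (cong [_] (n+n≡2*n (2 + N))))
  , (λ N → 3 + N , N≤3+N N , S N , 2≤ , edge , ēdge ,
      trans (cong₂ _*⁺_ (th*≡n-1 (S N) tw 2≤ edge) (th*≡n-1 (S̄ N) t̄w 2≤ ēdge))
            (cong [_] (n*n≡n^2 (2 + N))))
  where
  -- Order at least 3 provides two leaves, which are adjacent in the complement.
  S S̄ : ∀ N → Graph (3 + N)
  S N = star (2 + N)
  S̄ N = complement (S N)

  N≤3+N : ∀ N → N ≤ 3 + N
  N≤3+N N = ℕₚ.m≤n+m N 3

  2≤ : ∀ {N} → 2 ≤ 3 + N
  2≤ = s≤s (s≤s z≤n)

  tw : ∀ {N} → TwinLeaves (S N)
  tw = star-twinLeaves

  t̄w : ∀ {N} → TwinLeaves (S̄ N)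
  t̄w {N} = twinLeaves-complement (S N) star-twinLeaves

  edge : ∀ {N} → HasEdge (S N)
  edge = zero , suc zero , (λ ()) , inj₁ refl

  ēdge : ∀ {N} → HasEdge (S̄ N)
  ēdge = suc zero , suc (suc zero) , (λ ()) , λ { (_ , inj₁ ()) ; (_ , inj₂ ()) }
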